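{- If $G$ is a connected graph of order $n$, then $$L_2(G)\leq n+1-\Delta(G)-\left\lfloor \frac{\mathrm{diam}(G)-4}{3} \right\rfloor.$$
   Context: All graphs are finite, undirected, simple and nontrivial (at least two vertices). $\Delta(G)$ is the maximum degree, $\mathrm{diam}(G)$ the diameter, and $N[v]=\{v\}\cup N(v)$ the closed neighbourhood of $v$. A set $B\subseteq V(G)$ is a $2$-limited packing if $|N[v]\cap B|\le 2$ for every vertex $v$ of $G$; $L_2(G)$ is the maximum cardinality of a $2$-limited packing in $G$. The floor is that of a possibly negative rational number. -}

module Defs where

open import Data.Fin.Base using (Fin)
open import Data.Fin.Properties using (_≟_; all?; any?)
open import Data.Fin.Subset using (Subset; inside; outside; ⁅_⁆; _∪_; _∩_; ∣_∣)
open import Data.List.Base using (List; []; _∷_; _++_; map; filter; allFin; cartesianProductWith)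
open import Data.List.Extrema.Nat using (max)
open import Data.List.Membership.Propositional using (_∈_)
open import Data.List.Membership.Propositional.Properties using (∈-map⁺; ∈-++⁺ˡ; ∈-++⁺ʳ)
open import Data.List.Relation.Unary.Any using (here)
open import Data.Nat.Base using (ℕ; zero; suc; _≤_; z≤n; s≤s)
open import Data.Nat.Properties using (_≤?_)
open import Data.Product.Base using (∃; _×_; _,_; proj₁)
open import Data.Vec.Base using ([]; _∷_; tabulate)
open import Level using (0ℓ)
open import Relation.Binary.Core using (Rel)
open import Relation.Binary.Definitions using (Symmetric) renaming (Decidable to Decidable₂)
open import Relation.Binary.PropositionalEquality.Core using (refl)
open import Relation.Nullary.Decidable using (Dec; yes; no; does; map′; _×-dec_)
open import Relation.Nullary.Negation using (¬_; contradiction)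
open import Relation.Unary using (Pred; Decidable)

record Graph (n : ℕ) : Set₁ where
  field
    nontrivial : 2 ≤ n
    _~_        : Rel (Fin n) 0ℓ
    _~?_       : Decidable₂ _~_
    ~-sym      : Symmetric _~_
    ~-irrefl   : ∀ {v} → ¬ (v ~ v)

module _ {n : ℕ} (G : Graph n) where
  open Graph G

  N : Fin n → Subset n
  N v = tabulate (λ u → does (v ~? u))

  N[_] : Fin n → Subset n
  N[ v ] = ⁅ v ⁆ ∪ N v

  degree : Fin n → ℕ
  degree v = ∣ N v ∣

  -- max takes a default first; 0 is below every entry, so it never affects a nonempty list.
  Δ : ℕ
  Δ = max 0 (map degree (allFin n))

  data Walk : ℕ → Rel (Fin n) 0ℓ where
    nil  : ∀ {v} → Walk 0 v v
    cons : ∀ {k u w v} → u ~ w → Walk k w v → Walk (suc k) u v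

  Connected : Set
  Connected = ∀ u v → ∃ λ k → Walk k u v

  walk? : ∀ k u v → Dec (Walk k u v)
  walk? zero    u v = map′ (λ { refl → nil }) (λ { nil → refl }) (u ≟ v)
  walk? (suc k) u v =
    map′ (λ { (w , e , p) → cons e p }) (λ { (cons e p) → _ , e , p })
         (any? (λ w → (u ~? w) ×-dec walk? k w v))

Least : Pred ℕ 0ℓ → Pred ℕ 0ℓ
Least P m = P m × (∀ k → P k → m ≤ k)

least : ∀ {P : Pred ℕ 0ℓ} → Decidable P → ∀ k → P k → ∃ (Least P)
least P? zero p = zero , p , λ _ _ → z≤n
least P? (suc k) p with P? zero
... | yes p₀ = zero , p₀ , λ _ _ → z≤n
... | no ¬p₀ with least (λ i → P? (suc i)) k p
...   | m , pₘ , m≤ = suc m , pₘ , λ { zero p₀ → contradiction p₀ ¬p₀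
                                    ; (suc i) pᵢ → s≤s (m≤ i pᵢ) }

module _ {n : ℕ} (G : Graph n) (connected : Connected G) where

  dist : Fin n → Fin n → ℕ
  dist u v = let k , p = connected u v in proj₁ (least (λ i → walk? G i u v) k p)

  diam : ℕ
  diam = max 0 (cartesianProductWith dist (allFin n) (allFin n))

subsets : ∀ n → List (Subset n)
subsets zero    = [] ∷ []
subsets (suc n) = map (outside ∷_) (subsets n) ++ map (inside ∷_) (subsets n)

∈-subsets : ∀ {n} (B : Subset n) → B ∈ subsets n
∈-subsets []            = here refl
∈-subsets (outside ∷ B) = ∈-++⁺ˡ (∈-map⁺ (outside ∷_) (∈-subsets B))
∈-subsets (inside ∷ B)  =
  ∈-++⁺ʳ (map (outside ∷_) (subsets _)) (∈-map⁺ (inside ∷_) (∈-subsets B))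

module _ {n : ℕ} (G : Graph n) where

  Is2LimitedPacking : Pred (Subset n) 0ℓ
  Is2LimitedPacking B = ∀ v → ∣ N[_] G v ∩ B ∣ ≤ 2

  is2LimitedPacking? : Decidable Is2LimitedPacking
  is2LimitedPacking? B = all? (λ v → ∣ N[_] G v ∩ B ∣ ≤? 2)

  L₂ : ℕ
  L₂ = max 0 (map ∣_∣ (filter is2LimitedPacking? (subsets n)))

-- Fix a maximum 2-limited packing B. A set X lying in one closed neighbourhood has at least
-- |X| − 2 vertices outside B. Apply this to N[v] with v of maximum degree and to consecutive
-- triples of a diametral path from x to y. All these sets are separated by the distance to y: N[v]
-- occupies the levels j − 1, j, j + 1, where j = dist v y, and the triples are taken from the levels
-- below and above. This gives n − |B| ≥ (Δ − 1) + ⌊(j − 1)/3⌋ + ⌊(d − j − 1)/3⌋, and the two floors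
-- add up to at least ⌊(d − 4)/3⌋.

module Submission where

open import Defs
open import Data.Nat.Base using (ℕ)
open import Data.Integer.Base using (+_; _+_; _-_; _≤_)
open import Data.Rational.Unnormalised.Base using (_/_; floor)

import Data.Integer.Base as ℤ
import Data.Integer.DivMod as ℤ
import Data.Integer.Properties as ℤ
import Data.Nat.Base as ℕ
import Data.Nat.DivMod as ℕ
import Data.Nat.Properties as ℕ
import Data.Integer.Tactic.RingSolver as ℤ-Ring
import Data.Nat.Tactic.RingSolver as ℕ-Ring
import Data.List.Membership.Propositional as List
open import Data.Fin.Base using (Fin; fromℕ<)
open import Data.Fin.Subset
  using (Subset; inside; outside; ⊤; ⊥; ∁; ⁅_⁆; _∪_; _∩_; ∣_∣; _∈_; _∉_; _⊆_)
open import Data.Fin.Subset.Properties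
  using ( p⊆q⇒∣p∣≤∣q∣; x∈∁p⇒x∉p; x∉p⇒x∈∁p; x∈p∩q⁺; p∩q⊆p; p∩q⊆q; x∈p∪q⁻; p⊆p∪q; q⊆p∪q
        ; x∈⁅x⁆; x∈⁅y⁆⇒x≡y; ∣⁅x⁆∣≡1; ∣⊤∣≡n; ∣⊥∣≡0; ∈⊤; ∩-zeroʳ )
open import Data.List.Base using (allFin)
open import Data.List.Extrema.Nat using (max; argmax-sel; xs≤max)
open import Data.List.Membership.Propositional.Properties
  using (∈-map⁺; ∈-map⁻; ∈-map∘filter⁺; ∈-map∘filter⁻; ∈-allFin;
         ∈-cartesianProductWith⁺; ∈-cartesianProductWith⁻)
open import Data.List.Relation.Unary.All using () renaming (lookup to All-lookup)
open import Data.Nat.Base using (zero; suc; z≤n; s≤s)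
open import Data.Product.Base using (∃; _×_; _,_; proj₁; proj₂)
open import Data.Sum.Base using (inj₁; inj₂; [_,_]′)
open import Data.Vec.Base using ([]; _∷_; tabulate)
open import Data.Vec.Properties using (lookup∘tabulate; lookup⇒[]=; []=⇒lookup)
open import Function.Base using (_∘_; id; _$_)
open import Level using (0ℓ)
open import Relation.Binary.PropositionalEquality.Core
  using (_≡_; refl; sym; trans; cong; subst; subst₂)
open import Relation.Nullary.Decidable using (does; yes; no; dec-true)
open import Relation.Unary using (Pred; Decidable)

-- Subsets, cardinalities and maxima of lists.

module _ {n : ℕ} {P : Pred (Fin n) 0ℓ} (P? : Decidable P) where

  select : Subset n
  select = tabulate (does ∘ P?)

  ∈-select⁺ : ∀ {x} → P x → x ∈ select
  ∈-select⁺ {x} px = lookup⇒[]= x _ (trans (lookup∘tabulate _ x) (dec-true (P? x) px))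

  ∈-select⁻ : ∀ {x} → x ∈ select → P x
  ∈-select⁻ {x} x∈ with P? x | trans (sym (lookup∘tabulate (does ∘ P?) x)) ([]=⇒lookup x∈)
  ... | yes px | _ = px
  ... | no _   | ()

∣p∣≡∣p∩q∣+∣p∩∁q∣ : ∀ {n} (p q : Subset n) → ∣ p ∣ ≡ ∣ p ∩ q ∣ ℕ.+ ∣ p ∩ ∁ q ∣
∣p∣≡∣p∩q∣+∣p∩∁q∣ []            []            = refl
∣p∣≡∣p∩q∣+∣p∩∁q∣ (outside ∷ p) (_       ∷ q) = ∣p∣≡∣p∩q∣+∣p∩∁q∣ p q
∣p∣≡∣p∩q∣+∣p∩∁q∣ (inside  ∷ p) (inside  ∷ q) = cong suc (∣p∣≡∣p∩q∣+∣p∩∁q∣ p q)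
∣p∣≡∣p∩q∣+∣p∩∁q∣ (inside  ∷ p) (outside ∷ q) =
  trans (cong suc (∣p∣≡∣p∩q∣+∣p∩∁q∣ p q)) (sym (ℕ.+-suc ∣ p ∩ q ∣ _))

disjoint⇒∣p∣+∣q∣≤∣r∣ : ∀ {n} {p q r : Subset n} → p ⊆ r → q ⊆ r → (∀ {x} → x ∈ p → x ∉ q) →
                       ∣ p ∣ ℕ.+ ∣ q ∣ ℕ.≤ ∣ r ∣
disjoint⇒∣p∣+∣q∣≤∣r∣ {p = p} {q} {r} p⊆r q⊆r p#q = begin
  ∣ p ∣ ℕ.+ ∣ q ∣              ≤⟨ ℕ.+-mono-≤
                                   (p⊆q⇒∣p∣≤∣q∣ λ x∈p → x∈p∩q⁺ (p⊆r x∈p , x∈p))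
                                   (p⊆q⇒∣p∣≤∣q∣ λ x∈q → x∈p∩q⁺ (q⊆r x∈q , x∉p⇒x∈∁p λ x∈p → p#q x∈p x∈q)) ⟩
  ∣ r ∩ p ∣ ℕ.+ ∣ r ∩ ∁ p ∣    ≡⟨ ∣p∣≡∣p∩q∣+∣p∩∁q∣ r p ⟨
  ∣ r ∣                        ∎
  where open ℕ.≤-Reasoning

x∉p⇒∣p∣<∣⁅x⁆∪p∣ : ∀ {n x} {p : Subset n} → x ∉ p → ∣ p ∣ ℕ.< ∣ ⁅ x ⁆ ∪ p ∣
x∉p⇒∣p∣<∣⁅x⁆∪p∣ {x = x} {p} x∉p =
  subst (λ k → k ℕ.+ ∣ p ∣ ℕ.≤ ∣ ⁅ x ⁆ ∪ p ∣) (∣⁅x⁆∣≡1 x) $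
  disjoint⇒∣p∣+∣q∣≤∣r∣ (p⊆p∪q p) (q⊆p∪q ⁅ x ⁆ p)
    λ z∈⁅x⁆ → subst (_∉ p) (sym (x∈⁅y⁆⇒x≡y x z∈⁅x⁆)) x∉p

max-attained : ∀ {xs k} → k List.∈ xs → max 0 xs List.∈ xs
max-attained {xs} {k} k∈xs with argmax-sel id 0 xs
... | inj₂ max∈xs = max∈xs
-- If the maximum is the default 0, no entry exceeds 0, so the entry `k` is itself the maximum.
... | inj₁ max≡0  = subst (List._∈ xs) k≡max k∈xs
  where
  k≡max : k ≡ max 0 xs
  k≡max = ℕ.≤-antisym (All-lookup (xs≤max 0 xs) k∈xs) (subst (ℕ._≤ k) (sym max≡0) z≤n)

-- Rounding to multiples of three.

m≤2+m/3*3 : ∀ m → m ℕ.≤ 2 ℕ.+ m ℕ./ 3 ℕ.* 3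
m≤2+m/3*3 m = ℕ.≤-trans (ℕ.≤-reflexive (ℕ.m≡m%n+[m/n]*n m 3))
                        (ℕ.+-monoˡ-≤ _ (ℕ.s≤s⁻¹ (ℕ.m%n<n m 3)))

-- The six is 2 + 2 + 2: `suc j` exceeds `j ∸ 1` by at most 2, and each quotient drops a remainder
-- of at most 2.
d≤6+[[j-1]/3+[d-j-1]/3]*3 : ∀ d j → d ℕ.≤ 6 ℕ.+ ((j ℕ.∸ 1) ℕ./ 3 ℕ.+ (d ℕ.∸ suc j) ℕ./ 3) ℕ.* 3
d≤6+[[j-1]/3+[d-j-1]/3]*3 d j = begin
  d                                             ≤⟨ ℕ.m≤n+m∸n d (suc j) ⟩
  suc j ℕ.+ (d ℕ.∸ suc j)                       ≤⟨ ℕ.+-monoˡ-≤ _ (s≤s (ℕ.m≤n+m∸n j 1)) ⟩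
  2 ℕ.+ (j ℕ.∸ 1) ℕ.+ (d ℕ.∸ suc j)             ≤⟨ ℕ.+-mono-≤ (ℕ.+-monoʳ-≤ 2 (m≤2+m/3*3 (j ℕ.∸ 1)))
                                                               (m≤2+m/3*3 (d ℕ.∸ suc j)) ⟩
  2 ℕ.+ (2 ℕ.+ q₁ ℕ.* 3) ℕ.+ (2 ℕ.+ q₂ ℕ.* 3)   ≡⟨ regroup q₁ q₂ ⟩
  6 ℕ.+ (q₁ ℕ.+ q₂) ℕ.* 3                       ∎
  where
  open ℕ.≤-Reasoning
  q₁ = (j ℕ.∸ 1) ℕ./ 3
  q₂ = (d ℕ.∸ suc j) ℕ./ 3
  regroup : ∀ a b → 2 ℕ.+ (2 ℕ.+ a ℕ.* 3) ℕ.+ (2 ℕ.+ b ℕ.* 3) ≡ 6 ℕ.+ (a ℕ.+ b) ℕ.* 3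
  regroup = ℕ-Ring.solve-∀

-- Attained maxima and closed neighbourhoods.

module _ {n : ℕ} (G : Graph n) where
  open Graph G

  -- Witnesses that the lists of degrees and of distances are nonempty, so that their maxima are
  -- attained.
  vertex : Fin n
  vertex = fromℕ< (ℕ.≤-trans (s≤s z≤n) nontrivial)

  Δ-attained : ∃ λ v → Δ G ≡ degree G v
  Δ-attained with v , _ , eq ← ∈-map⁻ (degree G) (max-attained (∈-map⁺ (degree G) (∈-allFin vertex))) = v , eq

  -- Makes the list whose maximum is `L₂` nonempty.
  ⊥-is2LimitedPacking : Is2LimitedPacking G ⊥
  ⊥-is2LimitedPacking v =
    ℕ.≤-trans (ℕ.≤-reflexive (trans (cong ∣_∣ (∩-zeroʳ (N[_] G v))) (∣⊥∣≡0 n))) z≤n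

  L₂-attained : ∃ λ B → L₂ G ≡ ∣ B ∣ × Is2LimitedPacking G B
  L₂-attained
    with B , _ , eq , packing ← ∈-map∘filter⁻ ∣_∣ (is2LimitedPacking? G) {∣_∣} {subsets n}
           (max-attained (∈-map∘filter⁺ ∣_∣ (is2LimitedPacking? G) {∣_∣}
             (⊥ , ∈-subsets ⊥ , refl , ⊥-is2LimitedPacking))) = B , eq , packing

  ∈-N[]⁺ : ∀ {v u} → v ~ u → u ∈ N[_] G v
  ∈-N[]⁺ {v} v~u = q⊆p∪q ⁅ v ⁆ (N G v) (∈-select⁺ (v ~?_) v~u)

  v∈N[v] : ∀ v → v ∈ N[_] G v
  v∈N[v] v = p⊆p∪q (N G v) (x∈⁅x⁆ v)

  degree<∣N[]∣ : ∀ v → degree G v ℕ.< ∣ N[_] G v ∣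
  degree<∣N[]∣ v = x∉p⇒∣p∣<∣⁅x⁆∪p∣ λ v∈N → ~-irrefl (∈-select⁻ (v ~?_) v∈N)

  -- Counting outside the packing by levels, with `ℓ` standing for the distance to an endpoint.

  module Levels
    (ℓ : Fin n → ℕ)
    (ℓ-step : ∀ {u w} → u ~ w → ℓ u ℕ.≤ suc (ℓ w))
    (descend : ∀ {k} u → ℓ u ≡ suc k → ∃ λ w → u ~ w × ℓ w ≡ k)
    {B : Subset n} (packing : Is2LimitedPacking G B)
    where

    level<? : ∀ s → Decidable (λ u → ℓ u ℕ.< s)
    level<? s u = ℓ u ℕ.<? s

    -- A running total: raising the threshold `s` adds vertices of new levels only, so the
    -- contributions of separated sets accumulate without forming their union.
    below : ℕ → Subset n
    below s = ∁ B ∩ select (level<? s)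

    below⇒< : ∀ {s u} → u ∈ below s → ℓ u ℕ.< s
    below⇒< {s} u∈ = ∈-select⁻ (level<? s) (p∩q⊆q (∁ B) _ u∈)

    below-mono : ∀ {s t} → s ℕ.≤ t → below s ⊆ below t
    below-mono {t = t} s≤t u∈ =
      x∈p∩q⁺ (p∩q⊆p (∁ B) _ u∈ , ∈-select⁺ (level<? t) (ℕ.<-≤-trans (below⇒< u∈) s≤t))

    ∣B∣+∣below∣≤n : ∀ s → ∣ B ∣ ℕ.+ ∣ below s ∣ ℕ.≤ n
    ∣B∣+∣below∣≤n s = subst (∣ B ∣ ℕ.+ ∣ below s ∣ ℕ.≤_) (∣⊤∣≡n n) $
      disjoint⇒∣p∣+∣q∣≤∣r∣ (λ _ → ∈⊤) (λ _ → ∈⊤) λ x∈B x∈ → x∈∁p⇒x∉p (p∩q⊆p (∁ B) _ x∈) x∈B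

    -- The vertex `v` sees at most two members of `B`, so all but two vertices of `X` lie outside
    -- `B`. Their levels are at least `s`, so they are new, and less than `t`, so they are counted.
    below-gain : ∀ {v s t} {X : Subset n} → s ℕ.≤ t → X ⊆ N[_] G v →
                 (∀ {u} → u ∈ X → s ℕ.≤ ℓ u × ℓ u ℕ.< t) →
                 ∣ below s ∣ ℕ.+ ∣ X ∣ ℕ.≤ ∣ below t ∣ ℕ.+ 2
    below-gain {v} {s} {t} {X} s≤t X⊆N[v] levels = begin
      ∣ below s ∣ ℕ.+ ∣ X ∣                              ≡⟨ cong (∣ below s ∣ ℕ.+_) (∣p∣≡∣p∩q∣+∣p∩∁q∣ X B) ⟩
      ∣ below s ∣ ℕ.+ (∣ X ∩ B ∣ ℕ.+ ∣ X ∩ ∁ B ∣)        ≡⟨ swap (∣ below s ∣) (∣ X ∩ B ∣) _ ⟩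
      ∣ below s ∣ ℕ.+ ∣ X ∩ ∁ B ∣ ℕ.+ ∣ X ∩ B ∣          ≤⟨ ℕ.+-mono-≤ new old ⟩
      ∣ below t ∣ ℕ.+ 2                                  ∎
      where
      open ℕ.≤-Reasoning
      swap : ∀ a b c → a ℕ.+ (b ℕ.+ c) ≡ a ℕ.+ c ℕ.+ b
      swap = ℕ-Ring.solve-∀
      new : ∣ below s ∣ ℕ.+ ∣ X ∩ ∁ B ∣ ℕ.≤ ∣ below t ∣
      new = disjoint⇒∣p∣+∣q∣≤∣r∣ (below-mono s≤t)
        (λ x∈ → x∈p∩q⁺ (p∩q⊆q X _ x∈ , ∈-select⁺ (level<? t) (proj₂ (levels (p∩q⊆p X _ x∈)))))
        (λ x∈below x∈X → ℕ.<⇒≱ (below⇒< x∈below) (proj₁ (levels (p∩q⊆p X _ x∈X))))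
      old : ∣ X ∩ B ∣ ℕ.≤ 2
      old = ℕ.≤-trans
        (p⊆q⇒∣p∣≤∣q∣ λ x∈ → x∈p∩q⁺ (X⊆N[v] (p∩q⊆p X B x∈) , p∩q⊆q X B x∈)) (packing v)

    -- Each descent lowers the level by exactly one, so no level is skipped.
    level-inhabited : ∀ {i d} x → ℓ x ≡ d → i ℕ.≤′ d → ∃ λ u → ℓ u ≡ i
    level-inhabited x eq ℕ.≤′-refl       = x , eq
    level-inhabited x eq (ℕ.≤′-step i≤d) with w , _ , eq′ ← descend x eq = level-inhabited w eq′ i≤d

    ℓ<⇒∉⁅⁆ : ∀ {u w} → ℓ w ℕ.< ℓ u → u ∉ ⁅ w ⁆
    ℓ<⇒∉⁅⁆ {w = w} lt u∈ = ℕ.<-irrefl (cong ℓ (sym (x∈⁅y⁆⇒x≡y w u∈))) lt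

    -- A descent through the levels `2 + s`, `1 + s`, `s` gives neighbours a, b, c, distinct by
    -- level and all in the closed neighbourhood of b. Three vertices, at most two of them in `B`,
    -- leave a gain of one.
    below-triple : ∀ {s} x → 2 ℕ.+ s ℕ.≤ ℓ x → suc ∣ below s ∣ ℕ.≤ ∣ below (3 ℕ.+ s) ∣
    below-triple {s} x 2+s≤ℓx
      with a , ℓa ← level-inhabited x refl (ℕ.≤⇒≤′ 2+s≤ℓx)
      with b , a~b , ℓb ← descend a ℓa
      with c , b~c , ℓc ← descend b ℓb
      = ℕ.+-cancelʳ-≤ 2 _ _ $ ℕ.≤-trans
          (ℕ.≤-trans (ℕ.≤-reflexive (shift ∣ below s ∣)) (ℕ.+-monoʳ-≤ ∣ below s ∣ 3≤∣X∣))
          (below-gain (ℕ.m≤n+m s 3) X⊆N[b] levels)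
      where
      X : Subset n
      X = ⁅ a ⁆ ∪ (⁅ b ⁆ ∪ ⁅ c ⁆)
      shift : ∀ k → suc k ℕ.+ 2 ≡ k ℕ.+ 3
      shift = ℕ-Ring.solve-∀
      c<b : ℓ c ℕ.< ℓ b
      c<b = ℕ.≤-reflexive (trans (cong suc ℓc) (sym ℓb))
      b<a : ℓ b ℕ.< ℓ a
      b<a = ℕ.≤-reflexive (trans (cong suc ℓb) (sym ℓa))
      X-elim : (P : Fin n → Set) → P a → P b → P c → ∀ {u} → u ∈ X → P u
      X-elim P pa pb pc u∈ with x∈p∪q⁻ ⁅ a ⁆ _ u∈
      ... | inj₁ u∈a = subst P (sym (x∈⁅y⁆⇒x≡y a u∈a)) pa
      ... | inj₂ u∈bc with x∈p∪q⁻ ⁅ b ⁆ _ u∈bc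
      ...   | inj₁ u∈b = subst P (sym (x∈⁅y⁆⇒x≡y b u∈b)) pb
      ...   | inj₂ u∈c = subst P (sym (x∈⁅y⁆⇒x≡y c u∈c)) pc
      3≤∣X∣ : 3 ℕ.≤ ∣ X ∣
      3≤∣X∣ = ℕ.≤-trans
        (s≤s (ℕ.≤-trans (s≤s (ℕ.≤-reflexive (sym (∣⁅x⁆∣≡1 c)))) (x∉p⇒∣p∣<∣⁅x⁆∪p∣ (ℓ<⇒∉⁅⁆ c<b))))
        (x∉p⇒∣p∣<∣⁅x⁆∪p∣ λ a∈ →
          [ ℓ<⇒∉⁅⁆ b<a , ℓ<⇒∉⁅⁆ (ℕ.<-trans c<b b<a) ]′ (x∈p∪q⁻ ⁅ b ⁆ _ a∈))
      X⊆N[b] : X ⊆ N[_] G b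
      X⊆N[b] = X-elim (_∈ N[_] G b) (∈-N[]⁺ (~-sym a~b)) (v∈N[v] b) (∈-N[]⁺ b~c)
      levels : ∀ {u} → u ∈ X → s ℕ.≤ ℓ u × ℓ u ℕ.< 3 ℕ.+ s
      levels = X-elim (λ u → s ℕ.≤ ℓ u × ℓ u ℕ.< 3 ℕ.+ s)
        (bounds 2 ℕ.≤-refl ℓa) (bounds 1 (s≤s (s≤s z≤n)) ℓb) (bounds 0 (s≤s z≤n) ℓc)
        where
        bounds : ∀ {u} i → i ℕ.< 3 → ℓ u ≡ i ℕ.+ s → s ℕ.≤ ℓ u × ℓ u ℕ.< 3 ℕ.+ s
        bounds i i<3 eq = subst (λ k → s ℕ.≤ k × k ℕ.< 3 ℕ.+ s) (sym eq)
                                (ℕ.m≤n+m s i , ℕ.+-monoˡ-< s i<3)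

    -- The number `suc (ℓ x) ∸ s` counts the levels from `s` to `ℓ x`, and each triple uses up
    -- three. Every triple comes from its own descent from `x`; levels alone keep the triples apart.
    below-triples : ∀ m {s} x → m ℕ.* 3 ℕ.≤ suc (ℓ x) ℕ.∸ s →
                    m ℕ.+ ∣ below s ∣ ℕ.≤ ∣ below (m ℕ.* 3 ℕ.+ s) ∣
    below-triples zero        x _    = ℕ.≤-refl
    below-triples (suc m) {s} x room = begin
      suc m ℕ.+ ∣ below s ∣              ≡⟨ ℕ.+-suc m ∣ below s ∣ ⟨
      m ℕ.+ suc ∣ below s ∣              ≤⟨ ℕ.+-monoʳ-≤ m (below-triple x first) ⟩
      m ℕ.+ ∣ below (3 ℕ.+ s) ∣          ≤⟨ below-triples m x rest ⟩
      ∣ below (m ℕ.* 3 ℕ.+ (3 ℕ.+ s)) ∣  ≡⟨ cong (λ k → ∣ below k ∣) (shift (m ℕ.* 3) s) ⟩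
      ∣ below (suc m ℕ.* 3 ℕ.+ s) ∣      ∎
      where
      open ℕ.≤-Reasoning
      shift : ∀ k s → k ℕ.+ (3 ℕ.+ s) ≡ 3 ℕ.+ k ℕ.+ s
      shift = ℕ-Ring.solve-∀
      -- The difference in `room` is nonzero, hence not truncated, and can be turned into a sum.
      first : 2 ℕ.+ s ℕ.≤ ℓ x
      first = ℕ.s≤s⁻¹ (ℕ.m≤o∸n⇒m+n≤o 3 (ℕ.<⇒≤ (ℕ.m∸n≢0⇒n<m (ℕ.m<n⇒n≢0 room)))
                                       (ℕ.≤-trans (ℕ.m≤m+n 3 (m ℕ.* 3)) room))
      rest : m ℕ.* 3 ℕ.≤ suc (ℓ x) ℕ.∸ (3 ℕ.+ s)
      rest = subst (m ℕ.* 3 ℕ.≤_)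
        (trans (ℕ.∸-+-assoc (suc (ℓ x)) s 3) (cong (suc (ℓ x) ℕ.∸_) (ℕ.+-comm s 3)))
        (ℕ.∸-monoˡ-≤ 3 room)

    -- The closed neighbourhood has more than `degree G v` vertices, at most two of them in `B`: a
    -- gain of degree minus one, written additively. For `ℓ v` = 0 the truncated lower threshold is
    -- 0, still a valid bound.
    below-N[] : ∀ v → ∣ below (ℓ v ℕ.∸ 1) ∣ ℕ.+ degree G v ℕ.≤ suc ∣ below (2 ℕ.+ ℓ v) ∣
    below-N[] v = ℕ.s≤s⁻¹ (begin
      suc (∣ below j₀ ∣ ℕ.+ degree G v)  ≡⟨ ℕ.+-suc ∣ below j₀ ∣ _ ⟨
      ∣ below j₀ ∣ ℕ.+ suc (degree G v)  ≤⟨ ℕ.+-monoʳ-≤ ∣ below j₀ ∣ (degree<∣N[]∣ v) ⟩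
      ∣ below j₀ ∣ ℕ.+ ∣ N[_] G v ∣      ≤⟨ below-gain (ℕ.≤-trans (ℕ.m∸n≤m _ 1) (ℕ.m≤n+m _ 2)) id levels ⟩
      ∣ below (2 ℕ.+ ℓ v) ∣ ℕ.+ 2        ≡⟨ ℕ.+-comm _ 2 ⟩
      2 ℕ.+ ∣ below (2 ℕ.+ ℓ v) ∣        ∎)
      where
      open ℕ.≤-Reasoning
      j₀ = ℓ v ℕ.∸ 1
      levels : ∀ {u} → u ∈ N[_] G v → j₀ ℕ.≤ ℓ u × ℓ u ℕ.< 2 ℕ.+ ℓ v
      levels u∈ with x∈p∪q⁻ ⁅ v ⁆ _ u∈
      ... | inj₁ u∈v rewrite x∈⁅y⁆⇒x≡y v u∈v = ℕ.m∸n≤m _ 1 , ℕ.m≤n+m _ 1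
      ... | inj₂ u∈N with v~u ← ∈-select⁻ (v ~?_) u∈N =
        -- The edge is used in both directions, as adjacent levels differ by at most one.
        ℕ.∸-monoˡ-≤ 1 (ℓ-step v~u) , s≤s (ℓ-step (~-sym v~u))

    -- The threshold rises in three stages: triples lead from 0 to `ℓ v ∸ 1`, the closed
    -- neighbourhood of `v` leads to `2 + ℓ v`, and further triples lead on from there.
    packing-bound : ∀ x v → ℓ v ℕ.≤ ℓ x →
      ∣ B ∣ ℕ.+ degree G v ℕ.+ ((ℓ v ℕ.∸ 1) ℕ./ 3 ℕ.+ (ℓ x ℕ.∸ suc (ℓ v)) ℕ./ 3) ℕ.≤ suc n
    packing-bound x v ℓv≤ℓx = begin
      ∣ B ∣ ℕ.+ degree G v ℕ.+ (q₁ ℕ.+ q₂)          ≡⟨ regroup₁ (∣ B ∣) (degree G v) q₁ q₂ ⟩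
      ∣ B ∣ ℕ.+ (q₂ ℕ.+ (q₁ ℕ.+ degree G v))        ≤⟨ +-in (+-in₂ (ℕ.+-monoˡ-≤ (degree G v) left)) ⟩
      ∣ B ∣ ℕ.+ (q₂ ℕ.+ (∣ below (ℓ v ℕ.∸ 1) ∣ ℕ.+ degree G v))
                                                    ≤⟨ +-in (+-in₂ (below-N[] v)) ⟩
      ∣ B ∣ ℕ.+ (q₂ ℕ.+ suc ∣ below (2 ℕ.+ ℓ v) ∣)  ≡⟨ regroup₂ (∣ B ∣) q₂ _ ⟩
      suc (∣ B ∣ ℕ.+ (q₂ ℕ.+ ∣ below (2 ℕ.+ ℓ v) ∣))
                                                    -- The available room `suc (ℓ x) ∸ (2 + ℓ v)`
                                                    -- computes to `ℓ x ∸ suc (ℓ v)`, the number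
                                                    -- divided by 3 in `q₂`.
                                                    ≤⟨ s≤s (+-in (below-triples q₂ x (ℕ.m/n*n≤m _ 3))) ⟩
      suc (∣ B ∣ ℕ.+ ∣ below (q₂ ℕ.* 3 ℕ.+ (2 ℕ.+ ℓ v)) ∣)
                                                    ≤⟨ s≤s (∣B∣+∣below∣≤n (q₂ ℕ.* 3 ℕ.+ (2 ℕ.+ ℓ v))) ⟩
      suc n                                         ∎
      where
      open ℕ.≤-Reasoning
      q₁ = (ℓ v ℕ.∸ 1) ℕ./ 3
      q₂ = (ℓ x ℕ.∸ suc (ℓ v)) ℕ./ 3
      regroup₁ : ∀ b d q₁ q₂ → b ℕ.+ d ℕ.+ (q₁ ℕ.+ q₂) ≡ b ℕ.+ (q₂ ℕ.+ (q₁ ℕ.+ d))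
      regroup₁ = ℕ-Ring.solve-∀
      regroup₂ : ∀ b q r → b ℕ.+ (q ℕ.+ suc r) ≡ suc (b ℕ.+ (q ℕ.+ r))
      regroup₂ = ℕ-Ring.solve-∀
      +-in : ∀ {i j} → i ℕ.≤ j → ∣ B ∣ ℕ.+ i ℕ.≤ ∣ B ∣ ℕ.+ j
      +-in = ℕ.+-monoʳ-≤ ∣ B ∣
      +-in₂ : ∀ {i j} → i ℕ.≤ j → q₂ ℕ.+ i ℕ.≤ q₂ ℕ.+ j
      +-in₂ = ℕ.+-monoʳ-≤ q₂
      q₁*3≤ℓv∸1 : q₁ ℕ.* 3 ℕ.≤ ℓ v ℕ.∸ 1
      q₁*3≤ℓv∸1 = ℕ.m/n*n≤m _ 3
      left : q₁ ℕ.≤ ∣ below (ℓ v ℕ.∸ 1) ∣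
      left = begin
        q₁                            ≤⟨ ℕ.m≤m+n q₁ _ ⟩
        -- The lower triples are also found by descending from `x`, which is possible because `ℓ v`
        -- is at most `ℓ x`.
        q₁ ℕ.+ ∣ below 0 ∣            ≤⟨ below-triples q₁ x (ℕ.≤-trans q₁*3≤ℓv∸1
                                           (ℕ.≤-trans (ℕ.m∸n≤m _ 1) (ℕ.m≤n⇒m≤1+n ℓv≤ℓx))) ⟩
        ∣ below (q₁ ℕ.* 3 ℕ.+ 0) ∣    ≤⟨ p⊆q⇒∣p∣≤∣q∣ (below-mono
                                           (ℕ.≤-trans (ℕ.≤-reflexive (ℕ.+-identityʳ _)) q₁*3≤ℓv∸1)) ⟩
        ∣ below (ℓ v ℕ.∸ 1) ∣         ∎

-- Distances and a diametral pair.

module _ {n : ℕ} (G : Graph n) (connected : Connected G) where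
  open Graph G

  private
    d⟨_,_⟩ : Fin n → Fin n → ℕ
    d⟨_,_⟩ = dist G connected

  dist-walk : ∀ u v → Walk G d⟨ u , v ⟩ u v
  dist-walk u v = let k , p = connected u v in proj₁ (proj₂ (least (λ i → walk? G i u v) k p))

  dist-minimal : ∀ {k u v} → Walk G k u v → d⟨ u , v ⟩ ℕ.≤ k
  dist-minimal {u = u} {v} = let k , p = connected u v in
    proj₂ (proj₂ (least (λ i → walk? G i u v) k p)) _

  dist-step : ∀ y {u w} → u ~ w → d⟨ u , y ⟩ ℕ.≤ suc d⟨ w , y ⟩
  dist-step y u~w = dist-minimal (cons u~w (dist-walk _ y))

  -- The second vertex of a shortest walk serves: the rest of the walk bounds its distance from
  -- above, and `dist-step` excludes a larger drop.
  dist-descend : ∀ y {k} u → d⟨ u , y ⟩ ≡ suc k → ∃ λ w → u ~ w × d⟨ w , y ⟩ ≡ k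
  dist-descend y u eq with subst (λ k → Walk G k u y) eq (dist-walk u y)
  ... | cons u~w p = _ , u~w ,
    ℕ.≤-antisym (dist-minimal p) (ℕ.s≤s⁻¹ (subst (ℕ._≤ _) eq (dist-step y u~w)))

  dist∈ : ∀ x y → d⟨ x , y ⟩ List.∈ _
  dist∈ x y = ∈-cartesianProductWith⁺ d⟨_,_⟩ (∈-allFin x) (∈-allFin y)

  dist≤diam : ∀ x y → d⟨ x , y ⟩ ℕ.≤ diam G connected
  dist≤diam x y = All-lookup (xs≤max 0 _) (dist∈ x y)

  diam-attained : ∃ λ x → ∃ λ y → diam G connected ≡ d⟨ x , y ⟩
  diam-attained with x , y , _ , _ , eq ← ∈-cartesianProductWith⁻ d⟨_,_⟩ (allFin n) (allFin n)
                       (max-attained (dist∈ (vertex G) (vertex G))) = x , y , eq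

  -- The maxima enter as variables because Agda would otherwise unfold L₂, Δ and diam.
  packing-diametral-bound : ∀ {l δ d B v x y} →
    l ≡ ∣ B ∣ → Is2LimitedPacking G B → δ ≡ degree G v → d ≡ d⟨ x , y ⟩ → d⟨ v , y ⟩ ℕ.≤ d →
    ∃ λ q → l ℕ.+ δ ℕ.+ q ℕ.≤ suc n × d ℕ.≤ 6 ℕ.+ q ℕ.* 3
  packing-diametral-bound {v = v} {x} {y} refl packing refl refl v≤x =
    _ , packing-bound x v v≤x , d≤6+[[j-1]/3+[d-j-1]/3]*3 d⟨ x , y ⟩ d⟨ v , y ⟩
    where open Levels G (λ u → d⟨ u , y ⟩) (dist-step y) (dist-descend y) packing

  -- The two floors survive only through their sum `q` and the bound on the diameter, which is all
  -- that the comparison with the final floor needs.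
  L₂+Δ+q≤1+n : ∃ λ q → L₂ G ℕ.+ Δ G ℕ.+ q ℕ.≤ suc n × diam G connected ℕ.≤ 6 ℕ.+ q ℕ.* 3
  L₂+Δ+q≤1+n =
    let B , ∣B∣ , packing = L₂-attained G
        v , deg           = Δ-attained G
        x , y , eq        = diam-attained
    in packing-diametral-bound ∣B∣ packing deg eq (dist≤diam v y)

-- The integer floor and the final rearrangement.

floor[[d-4]/3]≤q : ∀ d q → d ℕ.≤ 6 ℕ.+ q ℕ.* 3 → floor ((+ d - + 4) / 3) ≤ + q
floor[[d-4]/3]≤q d q d≤ = ℤ.i<j⇒i≤pred[j] {j = + suc q} (ℤ.*-cancelʳ-<-nonNeg (+ 3) (begin-strict
  floor ((+ d - + 4) / 3) ℤ.* + 3  ≤⟨ ℤ.[n/d]*d≤n (+ d - + 4) (+ 3) ⟩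
  + d - + 4                        ≤⟨ ℤ.+-monoˡ-≤ (ℤ.- + 4) (ℤ.+≤+ d≤) ⟩
  -- Here 2 + 3q is one less than 3(q + 1), so cancelling 3 puts the floor strictly below `suc q`,
  -- hence at most `q`.
  + (2 ℕ.+ q ℕ.* 3)                <⟨ ℤ.+<+ ℕ.≤-refl ⟩
  + suc q ℤ.* + 3                  ∎))
  where open ℤ.≤-Reasoning

-- Subtraction takes place in the integers because `f` may be negative; replacing `q` by the smaller
-- `f` only enlarges the right side.
l+δ+q≤1+n⇒l≤n+1-δ-f : ∀ l δ q n {f} → l ℕ.+ δ ℕ.+ q ℕ.≤ suc n → f ≤ + q →
                       + l ≤ + n + + 1 - + δ - f
l+δ+q≤1+n⇒l≤n+1-δ-f l δ q n {f} bound f≤q = begin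
  + l                            ≡⟨ cancel (+ l) (+ δ) (+ q) ⟩
  + (l ℕ.+ δ ℕ.+ q) - + δ - + q  ≤⟨ ℤ.+-monoˡ-≤ (ℤ.- + q) (ℤ.+-monoˡ-≤ (ℤ.- + δ) (ℤ.+≤+ bound)) ⟩
  + suc n - + δ - + q            ≡⟨ cong (λ k → + k - + δ - + q) (ℕ.+-comm 1 n) ⟩
  + n + + 1 - + δ - + q          ≤⟨ ℤ.+-monoʳ-≤ (+ n + + 1 - + δ) (ℤ.neg-mono-≤ f≤q) ⟩
  + n + + 1 - + δ - f            ∎
  where
  open ℤ.≤-Reasoning
  cancel : ∀ l d q → l ≡ l + d + q - d - q
  cancel = ℤ-Ring.solve-∀

theorem4p8 : ∀ {n : ℕ} (G : Graph n) (connected : Connected G) →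
    + L₂ G ≤ + n + + 1 - + Δ G - floor ((+ diam G connected - + 4) / 3)
theorem4p8 {n} G connected =
  let q , bound , diam≤ = L₂+Δ+q≤1+n G connected
  in l+δ+q≤1+n⇒l≤n+1-δ-f (L₂ G) (Δ G) q n bound (floor[[d-4]/3]≤q (diam G connected) q diam≤)
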